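{- Let $A$ be a point or vector configuration of rank $r$ and let $T$ index a non-empty partial triangulation of $A$. If $T$ is right-extendable, then there is a covering set of simplex indices $C\subseteq\mathrm{adm}(T)$ such that (i) the covering set is pairwise properly intersecting: for each $s\in C$ and all $s'\in C\setminus\{s\}$ the simplices $s$ and $s'$ intersect properly; (ii) the covering set covers all free interior facets: for each $f\in\mathrm{free}(T)$ there is an $s\in C$ with $f\in\mathrm{intfacets}(s)$.
   Context: $A\in\mathbb{R}^{r\times n}$ has rank $r$ and columns $a_1,\dots,a_n$ (points in homogeneous coordinates, or vectors). A circuit is an inclusion-minimal linearly dependent set $C$ of column indices; a circuit signature splits $C=C_+\cup C_-$ such that $\sum_{i\in C_+}\lambda_ia_i=\sum_{i\in C_- }\lambda_ia_i$ for some $\lambda_i>0$, and $(C_+,C_-)$ is a signed circuit (each circuit yields two opposite ones). A cocircuit is an inclusion-maximal index set $C_0^*$ with $\operatorname{rank}(A_{C_0^*})<r$; with a non-zero $c\in\mathbb{R}^r$ satisfying $c^\top a_i=0$ exactly for $i\in C_0^*$ put $C_\pm^*=\{i:\pm c^\top a_i>0\}$. A simplex is an index set $S$ of size $r$ with $\operatorname{rank}(A_S)=r$; its facets are its $(r-1)$-subsets. Two simplices $S_1,S_2$ intersect properly if there is no signed circuit with $C_+\subseteq S_1$ and $C_-\subseteq S_2$. A simplex facet $F$ is interior if there is a cocircuit $C_0^*\supseteq F$ with $C_+^*$ and $C_-^*$ both non-empty. A triangulation is a non-empty set $\mathcal{T}$ of pairwise properly intersecting (feasible) simplices that is covering: for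 each interior facet $F$ of some $S\in\mathcal{T}$ there is another $S'\in\mathcal{T}$ containing $F$. A partial triangulation is a set of pairwise properly intersecting (feasible) simplices. (The set of feasible simplices, the ones considered in the enumeration, may be all simplices or a restricted set depending on the enumeration task.) Lexicographic order on sets of integers: $\emptyset\prec S$ for $S\ne\emptyset$; for non-empty $S,R$: $S\prec R$ iff $\min S<\min R$, or the minima agree and $S\setminus\{\min S\}\prec R\setminus\{\min R\}$. The $N$ feasible simplices are numbered $1,\dots,N$ in increasing lexicographic order, and the $M$ interior simplex facets are numbered $1,\dots,M$ in increasing lexicographic order; simplices and facets are identified with their numbers, and $T\subseteq\{1,\dots,N\}$ indexes the corresponding set of simplices. For $s\in\{1,\dots,N\}$, $\mathrm{intfacets}(s)\subseteq\{1,\dots,M\}$ is the set of (numbers of) interior facets of simplex $s$. For $T$ indexing a partial triangulation, $\mathrm{adm}(T)$ is the set of all $s\in\{1,\dots,N\}$ such that for all $s'\in T$: $s>s'$ and simplex $s$ intersects simplex $s'$ properly; $\mathrm{free}(T)$ is the set of $f\in\{1,\dots,M\}$ with $f\in\mathrm{intfacets}(s)$ for exactly one $s\in T$. $T$ is right-extendable if there is a $T'\supseteq T$ indexing a triangulation such that every element of $T'\setminus T$ is larger than every element of $T$. -}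

module Defs where

open import Level using (0ℓ; _⊔_; suc)
open import Algebra.Apartness.Bundles using (HeytingField; module HeytingCommutativeRing)
open import Algebra.Bundles using (CommutativeRing)
import Algebra.Definitions.RawMonoid as RawMonoidDefinitions
open import Data.Bool.Base using (if_then_else_)
open import Data.Fin.Base as Fin using (Fin)
open import Data.Fin.Subset using (Subset; _∈_; _⊆_; _⊂_; _∪_; _∩_; _─_; ∣_∣; ⊥; Nonempty; Empty)
  renaming (_-_ to _∖_)
open import Data.Nat.Base as ℕ using (ℕ)
open import Data.Product using (∃; ∃!; ∃-syntax; _×_)
open import Data.Sum.Base using (_⊎_)
open import Data.Vec.Base using (lookup)
open import Data.Vec.Functional using (Vector)
open import Function.Bundles using (_⇔_)
open import Relation.Binary.Core using (Rel)
open import Relation.Binary.PropositionalEquality using (_≡_; _≢_)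
open import Relation.Binary.Structures using (IsStrictPartialOrder)
open import Relation.Nullary.Negation using (¬_)
open import Relation.Unary using (Pred)

-- The real numbers, characterised as a Cauchy complete Archimedean ordered
-- field. Classically ℝ is the only model up to isomorphism. The axioms do not
-- ask for a decidable order, so that they also hold of constructive reals.
record RealNumbers c ℓ₁ ℓ₂ : Set (suc (c ⊔ ℓ₁ ⊔ ℓ₂)) where
  infix 4 _<_
  field
    heytingField : HeytingField c ℓ₁ ℓ₂

  open HeytingField heytingField public

  commutativeRing : CommutativeRing c ℓ₁
  commutativeRing = HeytingCommutativeRing.commutativeRing heytingCommutativeRing

  open RawMonoidDefinitions (CommutativeRing.+-rawMonoid commutativeRing) public
    using (sum) renaming (_×_ to _·_)

  field
    _<_                    : Rel Carrier ℓ₂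
    <-isStrictPartialOrder : IsStrictPartialOrder _≈_ _<_
    #⇔<⊎>                  : ∀ {x y} → x # y ⇔ (x < y ⊎ y < x)
    +-monoˡ-<              : ∀ z {x y} → x < y → x + z < y + z
    *-pos                  : ∀ {x y} → 0# < x → 0# < y → 0# < x * y
    archimedean            : ∀ x → ∃[ k ] x < k · 1#
    complete               :
      (x : ℕ → Carrier) →
      (∀ {ε} → 0# < ε → ∃[ K ] ∀ j k → K ℕ.≤ j → K ℕ.≤ k → x j - x k < ε) →
      ∃[ l ] ∀ {ε} → 0# < ε → ∃[ K ] ∀ k → K ℕ.≤ k → x k - l < ε × l - x k < ε

module _ {n : ℕ} where

  IsMin : Fin n → Subset n → Set
  IsMin i S = i ∈ S × (∀ {j} → j ∈ S → i Fin.≤ j)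

  infix 4 _≺_

  data _≺_ : Subset n → Subset n → Set where
    ∅≺    : ∀ {R} → Nonempty R → ⊥ ≺ R
    min<  : ∀ {S R i j} → IsMin i S → IsMin j R → i Fin.< j → S ≺ R
    min≡  : ∀ {S R i} → IsMin i S → IsMin i R → S ∖ i ≺ R ∖ i → S ≺ R

  -- The increasing enumeration of the sets satisfying P. Numbers start from 0,
  -- so Fin N plays the role of {1,…,N}.
  record LexNumbering {p} (P : Pred (Subset n) p) (N : ℕ) : Set p where
    field
      at         : Fin N → Subset n
      sound      : ∀ i → P (at i)
      exhaustive : ∀ {S} → P S → ∃[ i ] at i ≡ S
      increasing : ∀ {i j} → i Fin.< j → at i ≺ at j

module Configuration {c ℓ₁ ℓ₂} (ℝ : RealNumbers c ℓ₁ ℓ₂) {r n : ℕ}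
  (A : Fin r → Fin n → RealNumbers.Carrier ℝ) where

  open RealNumbers ℝ

  ∑∈ : Subset n → Vector Carrier n → Carrier
  ∑∈ S x = sum (λ i → if lookup S i then x i else 0#)

  -- The k-th coordinate of the sum of (w i) aᵢ over i ∈ S.
  combination : Subset n → Vector Carrier n → Vector Carrier r
  combination S w k = ∑∈ S (λ i → w i * A k i)

  IsDependent : Pred (Subset n) (c ⊔ ℓ₁ ⊔ ℓ₂)
  IsDependent S = ∃[ w ] (∃[ i ] i ∈ S × w i # 0#) × (∀ k → combination S w k ≈ 0#)

  IsIndependent : Pred (Subset n) (c ⊔ ℓ₁ ⊔ ℓ₂)
  IsIndependent S = ¬ IsDependent S

  -- rank (A_S) = d. A relation, since rank is not computable over ℝ.
  HasRank : Subset n → ℕ → Set (c ⊔ ℓ₁ ⊔ ℓ₂)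
  HasRank S d = (∃[ I ] I ⊆ S × IsIndependent I × ∣ I ∣ ≡ d)
              × (∀ {I} → I ⊆ S → IsIndependent I → ∣ I ∣ ℕ.≤ d)

  HasDeficientRank : Pred (Subset n) (c ⊔ ℓ₁ ⊔ ℓ₂)
  HasDeficientRank S = ∃[ d ] HasRank S d × d ℕ.< r

  IsCircuit : Pred (Subset n) (c ⊔ ℓ₁ ⊔ ℓ₂)
  IsCircuit C = IsDependent C × (∀ {D} → D ⊂ C → ¬ IsDependent D)

  IsSignedCircuit : Subset n → Subset n → Set (c ⊔ ℓ₁ ⊔ ℓ₂)
  IsSignedCircuit C₊ C₋ =
    IsCircuit (C₊ ∪ C₋) × Empty (C₊ ∩ C₋) ×
    ∃[ w ] (∀ {i} → i ∈ C₊ ∪ C₋ → 0# < w i)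
         × (∀ k → combination C₊ w k ≈ combination C₋ w k)

  IsCocircuit : Pred (Subset n) (c ⊔ ℓ₁ ⊔ ℓ₂)
  IsCocircuit C₀ = HasDeficientRank C₀ × (∀ {D} → C₀ ⊂ D → ¬ HasDeficientRank D)

  evaluate : Vector Carrier r → Fin n → Carrier
  evaluate v i = sum (λ k → v k * A k i)

  IsNormal : Subset n → Vector Carrier r → Set (ℓ₁ ⊔ ℓ₂)
  IsNormal C₀ v = (∃[ k ] v k # 0#) × (∀ i → i ∈ C₀ ⇔ evaluate v i ≈ 0#)

  IsSimplex : Pred (Subset n) (c ⊔ ℓ₁ ⊔ ℓ₂)
  IsSimplex S = ∣ S ∣ ≡ r × HasRank S r

  IsFacetOf : Subset n → Subset n → Set
  IsFacetOf F S = F ⊆ S × ℕ.suc ∣ F ∣ ≡ r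

  IntersectProperly : Subset n → Subset n → Set (c ⊔ ℓ₁ ⊔ ℓ₂)
  IntersectProperly S₁ S₂ =
    ¬ (∃[ C₊ ] ∃[ C₋ ] IsSignedCircuit C₊ C₋ × C₊ ⊆ S₁ × C₋ ⊆ S₂)

  IsInteriorFacet : Pred (Subset n) (c ⊔ ℓ₁ ⊔ ℓ₂)
  IsInteriorFacet F =
    (∃[ S ] IsSimplex S × IsFacetOf F S) ×
    ∃[ C₀ ] IsCocircuit C₀ × F ⊆ C₀ ×
    ∃[ v ] IsNormal C₀ v × (∃[ i ] 0# < evaluate v i) × (∃[ i ] evaluate v i < 0#)

  module Enumeration {ℓ} (Feasible : Pred (Subset n) ℓ) {N M : ℕ}
    (simplices : LexNumbering Feasible N) (facets : LexNumbering IsInteriorFacet M) where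

    open LexNumbering simplices using () renaming (at to simplex)
    open LexNumbering facets using () renaming (at to facet)

    IsPartialTriangulation : Pred (Pred (Subset n) 0ℓ) (c ⊔ ℓ₁ ⊔ ℓ₂ ⊔ ℓ)
    IsPartialTriangulation 𝒯 =
      (∀ {S} → 𝒯 S → Feasible S) ×
      (∀ {S S′} → 𝒯 S → 𝒯 S′ → S ≢ S′ → IntersectProperly S S′)

    IsCovering : Pred (Pred (Subset n) 0ℓ) (c ⊔ ℓ₁ ⊔ ℓ₂)
    IsCovering 𝒯 = ∀ {S F} → 𝒯 S → IsFacetOf F S → IsInteriorFacet F →
      ∃[ S′ ] 𝒯 S′ × S′ ≢ S × F ⊆ S′

    IsTriangulation : Pred (Pred (Subset n) 0ℓ) (c ⊔ ℓ₁ ⊔ ℓ₂ ⊔ ℓ)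
    IsTriangulation 𝒯 = ∃ 𝒯 × IsPartialTriangulation 𝒯 × IsCovering 𝒯

    ⟦_⟧ : Subset N → Pred (Subset n) 0ℓ
    ⟦ T ⟧ S = ∃[ s ] s ∈ T × simplex s ≡ S

    intfacets : Fin N → Pred (Fin M) 0ℓ
    intfacets s f = IsFacetOf (facet f) (simplex s)

    adm : Subset N → Pred (Fin N) (c ⊔ ℓ₁ ⊔ ℓ₂)
    adm T s = ∀ {s′} → s′ ∈ T → s′ Fin.< s × IntersectProperly (simplex s) (simplex s′)

    free : Subset N → Pred (Fin M) 0ℓ
    free T f = ∃! _≡_ (λ s → s ∈ T × intfacets s f)

    RightExtendable : Pred (Subset N) (c ⊔ ℓ₁ ⊔ ℓ₂ ⊔ ℓ)
    RightExtendable T = ∃[ T′ ] T ⊆ T′ × IsTriangulation ⟦ T′ ⟧ ×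
      (∀ {s t} → s ∈ T′ ─ T → t ∈ T → t Fin.< s)

    PairwiseProper : Pred (Subset N) (c ⊔ ℓ₁ ⊔ ℓ₂)
    PairwiseProper C = ∀ {s s′} → s ∈ C → s′ ∈ C → s′ ≢ s →
      IntersectProperly (simplex s) (simplex s′)

    Covers : Subset N → Pred (Fin M) 0ℓ → Set
    Covers C Φ = ∀ {f} → Φ f → ∃[ s ] s ∈ C × intfacets s f

{-# OPTIONS --safe #-}

-- If T′ ⊇ T witnesses right-extendability, then C = T′ ∖ T works. An interior
-- facet F of exactly one s ∈ T lies in a second simplex of T′, because T′ is
-- covering, and freeness of F keeps that simplex out of T.

module Submission where

open import Defs
open import Data.Fin.Base using (Fin)
open import Data.Fin.Properties using (<-cmp; <⇒≢)
open import Data.Fin.Subset using (Subset; _∈_; _∉_; _─_; ⊤; Nonempty)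
open import Data.Fin.Subset.Properties using (∉⊥; p─q⊆p; x∈p∧x∉q⇒x∈p─q)
open import Data.Nat.Base using (ℕ)
open import Data.Nat.Properties using (<⇒≱)
open import Data.Product.Base using (∃-syntax; _×_; _,_)
open import Function.Base using (_∘_)
open import Function.Definitions using (Injective)
open import Relation.Binary.Definitions using (Irreflexive; tri<; tri≈; tri>)
open import Relation.Binary.PropositionalEquality using (_≡_; refl; sym; cong)
open import Relation.Nullary.Negation using (contradiction)
open import Relation.Unary using (Pred)

-- Induction on the derivation: `∅≺` would need an element of the empty set, `min<` would put one
-- minimum of a set strictly below another, and `min≡` leaves a smaller derivation of the same kind.
≺-irrefl : ∀ {n} → Irreflexive _≡_ (_≺_ {n})
≺-irrefl refl (∅≺ (_ , i∈⊥))                  = ∉⊥ i∈⊥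
≺-irrefl refl (min< (i∈S , _) (_ , j≤S) i<j) = <⇒≱ i<j (j≤S i∈S)
≺-irrefl refl (min≡ _ _ S∖i≺S∖i)             = ≺-irrefl refl S∖i≺S∖i

-- Bridges sets and numbers: a triangulation separates simplices as sets, `PairwiseProper` by their
-- indices.
at-injective : ∀ {n p N} {P : Pred (Subset n) p} (numbering : LexNumbering P N) →
  Injective _≡_ _≡_ (LexNumbering.at numbering)
at-injective numbering {i} {j} eq with <-cmp i j
... | tri< i<j _ _ = contradiction (LexNumbering.increasing numbering i<j) (≺-irrefl eq)
... | tri≈ _ i≡j _ = i≡j
... | tri> _ _ j<i = contradiction (LexNumbering.increasing numbering j<i) (≺-irrefl (sym eq))

theorem11 : ∀ {c ℓ₁ ℓ₂ ℓ} (ℝ : RealNumbers c ℓ₁ ℓ₂) {r n : ℕ}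
    (A : Fin r → Fin n → RealNumbers.Carrier ℝ) →
    let open Configuration ℝ A in
    HasRank ⊤ r →
    (Feasible : Pred (Subset n) ℓ) → (∀ {S} → Feasible S → IsSimplex S) →
    ∀ {N M : ℕ} (simplices : LexNumbering Feasible N)
    (facets : LexNumbering IsInteriorFacet M) →
    let open Enumeration Feasible simplices facets in
    (T : Subset N) → Nonempty T → IsPartialTriangulation ⟦ T ⟧ →
    RightExtendable T →
    ∃[ C ] (∀ {s} → s ∈ C → adm T s) × PairwiseProper C × Covers C (free T)
theorem11 ℝ A _ Feasible _ simplices facets T _ _
  (T′ , T⊆T′ , (_ , (_ , proper) , covering) , T<T′─T) =
  T′ ─ T , admissible , pairwiseProper , covers
  where
  open Configuration ℝ A
  open Enumeration Feasible simplices facets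
  open LexNumbering simplices using () renaming (at to simplex)

  properlyIn-T′ : PairwiseProper T′
  properlyIn-T′ s∈T′ s′∈T′ s′≢s =
    proper (_ , s∈T′ , refl) (_ , s′∈T′ , refl) (s′≢s ∘ sym ∘ at-injective simplices)

  admissible : ∀ {s} → s ∈ T′ ─ T → adm T s
  admissible s∈C s′∈T =
    -- The order condition of right-extendability also supplies the distinctness that properness in
    -- `T′` asks for.
    s′<s , properlyIn-T′ (p─q⊆p T′ T s∈C) (T⊆T′ s′∈T) (<⇒≢ s′<s)
    where
    s′<s = T<T′─T s∈C s′∈T

  pairwiseProper : PairwiseProper (T′ ─ T)
  pairwiseProper s∈C s′∈C = properlyIn-T′ (p─q⊆p T′ T s∈C) (p─q⊆p T′ T s′∈C)

  covers : Covers (T′ ─ T) (free T)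
  covers {f} (s , (s∈T , F⊆S , ∣F∣+1≡r) , unique)
    with covering (s , T⊆T′ s∈T , refl) (F⊆S , ∣F∣+1≡r) (LexNumbering.sound facets f)
  ... | _ , (s′ , s′∈T′ , refl) , S′≢S , F⊆S′ =
    -- The size condition on a facet does not mention the simplex, so it carries over from `s` to
    -- `s′`.
    s′ , x∈p∧x∉q⇒x∈p─q s′∈T′ s′∉T , F⊆S′ , ∣F∣+1≡r
    where
    s′∉T : s′ ∉ T
    -- Uniqueness would identify the indices `s` and `s′`, but the covering property makes their
    -- simplices differ as sets.
    s′∉T s′∈T = S′≢S (sym (cong simplex (unique (s′∈T , F⊆S′ , ∣F∣+1≡r))))
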